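{- Let $T$ be a rectangle. There exists an integer $n_0 = n_0(T)$, depending only on $T$, such that for every positive integer $r$ and all integers $n \ge n_0$, \[ \mathbb{E}^{n} \overset{r}{\rightarrow} (T; T)_{\mathrm{GR}}, \] that is, for every coloring $\chi : \mathbb{E}^n \to \{1,\dots,r\}$ there exists in $\mathbb{E}^n$ a monochromatic congruent copy of $T$ or a rainbow congruent copy of $T$.
   Context: $\mathbb{E}^n$ denotes $n$-dimensional Euclidean space. A rectangle $T$ is regarded as the four-point configuration consisting of the vertices of a (non-degenerate) rectangle with arbitrary positive real side lengths. A congruent copy of a finite configuration $K$ is a set of points isometric to $K$. A copy is monochromatic if all its points receive the same color, and rainbow if all its points receive pairwise distinct colors. For finite configurations $K_1, K_2$, the notation $\mathbb{E}^n \overset{r}{\rightarrow} (K_1;K_2)_{\mathrm{GR}}$ means: every coloring $\chi:\mathbb{E}^n\to\{1,\dots,r\}$ contains a monochromatic congruent copy of $K_1$ or a rainbow congruent copy of $K_2$. -}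

module Defs where

open import Algebra.Bundles using (CommutativeRing)
open import Data.Fin.Base using (Fin)
open import Data.Fin.Patterns using (0F; 1F; 2F; 3F)
open import Data.Nat.Base using (ℕ)
open import Data.Product.Base using (Σ; ∃; _×_)
open import Data.Sum.Base using (_⊎_)
open import Data.Vec.Functional using (Vector)
open import Function.Bundles using (Func)
open import Function.Definitions using (Injective)
open import Level using (0ℓ)
open import Relation.Binary.Bundles using (Setoid)
open import Relation.Binary.Core using (Rel)
open import Relation.Binary.PropositionalEquality as ≡ using (_≡_)
open import Relation.Binary.Structures using (IsTotalOrder)
open import Relation.Nullary.Negation using (¬_)
open import Relation.Unary using (Pred)
import Algebra.Properties.Semiring.Sum as Sum
import Data.Vec.Functional.Relation.Binary.Equality.Setoid as VectorEquality

-- The standard library has no real numbers, so ℝ enters through its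
-- axiomatic characterisation: classically, Dedekind-complete ordered fields
-- exist and any two of them are isomorphic.
record CompleteOrderedField : Set₁ where
  infix 4 _≤_
  field
    commutativeRing : CommutativeRing 0ℓ 0ℓ
  open CommutativeRing commutativeRing public
  field
    _≤_          : Rel Carrier 0ℓ
    isTotalOrder : IsTotalOrder _≈_ _≤_
    1≉0          : ¬ (1# ≈ 0#)
    inverse      : ∀ x → ¬ (x ≈ 0#) → ∃ λ y → x * y ≈ 1#
    +-monoˡ-≤    : ∀ z {x y} → x ≤ y → x + z ≤ y + z
    *-nonNeg     : ∀ {x y} → 0# ≤ x → 0# ≤ y → 0# ≤ x * y

  UpperBound : Pred Carrier 0ℓ → Pred Carrier 0ℓ
  UpperBound P b = ∀ x → P x → x ≤ b

  field
    supremum : (P : Pred Carrier 0ℓ) → ∃ P → ∃ (UpperBound P) →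
               ∃ λ s → UpperBound P s × (∀ b → UpperBound P b → s ≤ b)

module Euclidean (ℝ : CompleteOrderedField) where

  open CompleteOrderedField ℝ
  open Sum semiring using (sum)
  open VectorEquality setoid using (_≋_; ≋-setoid)

  Point : ℕ → Set
  Point n = Vector Carrier n

  𝔼 : ℕ → Setoid 0ℓ 0ℓ
  𝔼 = ≋-setoid

  infixl 6 _⊖_
  _⊖_ : ∀ {n} → Point n → Point n → Point n
  (x ⊖ y) i = x i - y i

  infix 7 _∙_
  _∙_ : ∀ {n} → Point n → Point n → Carrier
  x ∙ y = sum (λ i → x i * y i)

  dist² : ∀ {n} → Point n → Point n → Carrier
  dist² x y = (x ⊖ y) ∙ (x ⊖ y)

  -- A set of k points, listed without repetition.
  record Configuration (d k : ℕ) : Set where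
    field
      points   : Fin k → Point d
      distinct : Injective _≡_ _≋_ points

  -- Distances are nonnegative, so preserving them is the same as preserving
  -- their squares; in particular the points of a copy are again distinct.
  record CongruentCopy {d k} (K : Configuration d k) (n : ℕ) : Set where
    open Configuration K
    field
      copy      : Fin k → Point n
      isometric : ∀ i j → dist² (copy i) (copy j) ≈ dist² (points i) (points j)

  -- The vertices 0F, 1F, 2F, 3F are in cyclic order.  Non-degeneracy is the
  -- distinctness of the vertices.
  record Rectangle (d : ℕ) : Set where
    field
      vertices : Configuration d 4
    open Configuration vertices public
    field
      parallelogram : points 1F ⊖ points 0F ≋ points 2F ⊖ points 3F
      rightAngle    : (points 1F ⊖ points 0F) ∙ (points 3F ⊖ points 0F) ≈ 0#

  -- A function on 𝔼ⁿ has to respect the equality of points.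
  Coloring : ℕ → ℕ → Set
  Coloring n r = Func (𝔼 n) (≡.setoid (Fin r))

  module _ {n r d k} (χ : Coloring n r) {K : Configuration d k} where
    open CongruentCopy
    open Func χ using (to)

    Monochromatic : CongruentCopy K n → Set
    Monochromatic C = ∀ i j → to (copy C i) ≡ to (copy C j)

    Rainbow : CongruentCopy K n → Set
    Rainbow C = Injective _≡_ _≡_ (λ i → to (copy C i))

  infix 4 𝔼^_⟶[_]⟨_⨾_⟩GR
  𝔼^_⟶[_]⟨_⨾_⟩GR : ∀ (n r : ℕ) {d₁ k₁ d₂ k₂} →
                      Configuration d₁ k₁ → Configuration d₂ k₂ → Set
  𝔼^ n ⟶[ r ]⟨ K₁ ⨾ K₂ ⟩GR =
    (χ : Coloring n r) →
    Σ (CongruentCopy K₁ n) (Monochromatic χ) ⊎ Σ (CongruentCopy K₂ n) (Rainbow χ)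

{-# OPTIONS --safe #-}

-- The colouring is restricted to a grid: a product of k regular simplices with
-- N vertices each and squared edge lengths w₁, …, w_k, where k and the weights
-- depend only on T.  A canonical Ramsey theorem, with N independent of the
-- number of colours, gives two vertices in each simplex and a set I of
-- coordinates such that two of the resulting 2ᵏ grid points have the same
-- colour iff they agree on I.  Disjoint sets U, V of coordinates whose weights
-- add up to the two squared sides of T span a copy of T, which is rainbow if
-- both U and V meet I, and monochromatic if neither does.  The weights are
-- chosen so that for every I some such pair (U, V) is of one of the two kinds.
--
-- The canonical theorem follows from the product Ramsey theorem for pairs: a
-- k-tuple of pairs is coloured by the equality pattern of the colouring on the
-- cube that it spans, and there are finitely many patterns.

module Submission where

open import Defs
open import Axiom.ExcludedMiddle using (ExcludedMiddle)
open import Data.Bool.Base using (Bool; true; false; not; if_then_else_; _xor_)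
import Data.Bool.Properties as Bool
open import Data.Empty using (⊥-elim)
open import Data.Fin.Base as Fin
  using (Fin; zero; suc; _↑ˡ_; _↑ʳ_; combine; funToFin; finToFun; punchOut; splitAt)
open import Data.Fin.Patterns using (0F; 1F; 2F; 3F)
import Data.Fin.Properties as Fin
open import Data.Maybe.Base as Maybe using (Maybe; just; nothing; maybe)
open import Data.Nat.Base as ℕ using (ℕ; zero; suc; z≤n; s≤s)
import Data.Nat.Properties as ℕ
open import Data.Product.Base using (Σ; ∃; _×_; _,_; proj₁; proj₂)
open import Data.Sum.Base using (_⊎_; inj₁; inj₂)
open import Data.Vec.Base using (Vec; []; _∷_; lookup; map; replicate; tabulate; _[_]≔_)
  renaming (_⊛_ to infixl 5 _⊛_)
open import Data.Vec.Functional using (_++_)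
open import Data.Vec.Properties using (lookup∘tabulate; lookup∘update; lookup-map; lookup-replicate)
open import Data.Vec.Relation.Binary.Pointwise.Inductive using (Pointwise; []; _∷_)
open import Data.Vec.Relation.Unary.All as All using (All; []; _∷_)
import Data.Vec.Relation.Unary.All.Properties as All
open import Function.Base using (_∘_)
open import Function.Bundles using (Func)
open import Function.Definitions using (Injective)
open import Level using (0ℓ)
open import Relation.Binary.Bundles using (Poset)
open import Relation.Binary.Core using (Rel; _Preserves_⟶_)
open import Relation.Binary.Definitions using (tri<; tri≈; tri>)
open import Relation.Binary.PropositionalEquality as ≡ using (_≡_; _≢_)
open import Relation.Binary.Structures using (IsTotalOrder)
open import Relation.Nullary.Decidable.Core using (Dec; yes; no; does)
open import Relation.Nullary.Negation using (¬_; contradiction)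
open import Relation.Unary using (Pred; Decidable)
import Algebra.Properties.CommutativeSemigroup
import Algebra.Properties.Ring
import Algebra.Properties.Semiring.Mult
import Algebra.Properties.Semiring.Sum
import Algebra.Solver.Ring.NaturalCoefficients.Default
import Data.Vec.Functional.Relation.Binary.Equality.Setoid
import Relation.Binary.Reasoning.PartialOrder
import Relation.Binary.Reasoning.Setoid

module BoxRamsey where

  open import Data.Nat.Base using (_+_; _*_; _^_)
  open ≡ using (refl; sym; trans; cong; cong₂; subst₂; module ≡-Reasoning)

  -- Pigeonhole principle and Ramsey's theorem for pairs.

  Increasing : ∀ {m n} → (Fin m → Fin n) → Set
  Increasing f = f Preserves Fin._<_ ⟶ Fin._<_

  increasing⇒injective : ∀ {m n} {f : Fin m → Fin n} → Increasing f → Injective _≡_ _≡_ f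
  increasing⇒injective f↑ {i} {j} eq with Fin.<-cmp i j
  ... | tri< i<j _ _ = contradiction (f↑ i<j) (Fin.<-irrefl eq)
  ... | tri≈ _ i≡j _ = i≡j
  ... | tri> _ _ j<i = contradiction (f↑ j<i) (Fin.<-irrefl (sym eq))

  prepend : ∀ {m n} → (Fin m → Fin n) → Fin (suc m) → Fin (suc n)
  prepend f zero    = zero
  prepend f (suc i) = suc (f i)

  prepend-increasing : ∀ {m n} {f : Fin m → Fin n} → Increasing f → Increasing (prepend f)
  prepend-increasing f↑ {zero}  {suc j} _         = s≤s z≤n
  prepend-increasing f↑ {suc i} {suc j} (s≤s i<j) = s≤s (f↑ i<j)

  Selection : ∀ {n} → ℕ → Pred (Fin n) 0ℓ → Set
  Selection {n} m P = ∃ λ (f : Fin m → Fin n) → Increasing f × (∀ i → P (f i))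

  -- Point zero lies in one of the two classes, and the target of that class drops by one for the
  -- remaining points. If the recursion fills this class, point zero is put in front; otherwise it
  -- is dropped.
  pigeonhole₂ : ∀ {N} a b → N ≡ a + b → {P : Pred (Fin N) 0ℓ} → Decidable P →
                Selection a P ⊎ Selection b (¬_ ∘ P)
  pigeonhole₂ zero    b    eq P? = inj₁ ((λ ()) , (λ { {()} }) , λ ())
  pigeonhole₂ (suc a) zero eq P? = inj₂ ((λ ()) , (λ { {()} }) , λ ())
  pigeonhole₂ {suc N} (suc a) (suc b) eq P? with P? zero
  ... | yes p with pigeonhole₂ a (suc b) (ℕ.suc-injective eq) (P? ∘ suc)
  ...   | inj₁ (f , f↑ , h) = inj₁ (prepend f , prepend-increasing f↑ , λ { zero → p ; (suc i) → h i })
  ...   | inj₂ (f , f↑ , h) = inj₂ (suc ∘ f , s≤s ∘ f↑ , h)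
  pigeonhole₂ {suc N} (suc a) (suc b) eq P? | no ¬p
    with pigeonhole₂ (suc a) b (trans (ℕ.suc-injective eq) (ℕ.+-suc a b)) (P? ∘ suc)
  ... | inj₁ (f , f↑ , h) = inj₁ (suc ∘ f , s≤s ∘ f↑ , h)
  ... | inj₂ (f , f↑ , h) = inj₂ (prepend f , prepend-increasing f↑ , λ { zero → ¬p ; (suc i) → h i })

  pigeonhole : ∀ q m → ∃ λ N → (c : Fin N → Fin q) → ∃ λ κ → Selection m (λ i → c i ≡ κ)
  -- Without colours a single point already rules out any colouring; the empty set would admit one
  -- and leave no `κ` to return.
  pigeonhole zero    m = 1 , λ c → ⊥-elim (Fin.¬Fin0 (c zero))
  pigeonhole (suc q) m with pigeonhole q m
  ... | N , select = m + N , go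
    where
    go : (c : Fin (m + N) → Fin (suc q)) → ∃ λ κ → Selection m (λ i → c i ≡ κ)
    go c with pigeonhole₂ m N refl (λ i → c i Fin.≟ zero)
    ... | inj₁ s = zero , s
    -- Colour zero does not occur on the image of `f`, so punching it out leaves `q` colours.
    ... | inj₂ (f , f↑ , nonzero) with select (λ i → punchOut (nonzero i ∘ sym))
    ...   | κ , g , g↑ , const =
      suc κ , f ∘ g , f↑ ∘ g↑ ,
      λ i → trans (sym (Fin.punchIn-punchOut (nonzero (g i) ∘ sym))) (cong suc (const i))

  -- Keep point zero, thin out the later points until all of them have the same colour with it, and
  -- recurse among those. The size `N` for the recursion is fixed first, since so many points have
  -- to survive the thinning.
  endHomogeneous : ∀ q m → ∃ λ N → (c : Fin N → Fin N → Fin q) →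
    ∃ λ (f : Fin m → Fin N) → Increasing f ×
    ∃ λ (κ : Fin m → Fin q) → ∀ {i j} → i Fin.< j → c (f i) (f j) ≡ κ i
  endHomogeneous q zero = 0 , λ c → (λ ()) , (λ { {()} }) , (λ ()) , λ { {()} }
  endHomogeneous q (suc m) with endHomogeneous q m
  ... | N , ih with pigeonhole q N
  ...   | M , select = suc M , go
    where
    go : (c : Fin (suc M) → Fin (suc M) → Fin q) →
         ∃ λ (f : Fin (suc m) → Fin (suc M)) → Increasing f ×
         ∃ λ (κ : Fin (suc m) → Fin q) → ∀ {i j} → i Fin.< j → c (f i) (f j) ≡ κ i
    go c with select (c zero ∘ suc)
    ... | κ₀ , g , g↑ , const with ih (λ x y → c (suc (g x)) (suc (g y)))
    ...   | f , f↑ , κ , hom =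
      prepend (g ∘ f) , prepend-increasing (g↑ ∘ f↑) , (λ { zero → κ₀ ; (suc i) → κ i }) ,
      λ { {zero} {suc j} _ → const (f j) ; {suc i} {suc j} (s≤s i<j) → hom i<j }

  -- After `endHomogeneous` the colour of a pair is a colour of its smaller element, and the
  -- pigeonhole principle makes that one constant.
  ramsey : ∀ q m → ∃ λ N → (c : Fin N → Fin N → Fin q) →
    ∃ λ (f : Fin m → Fin N) → Increasing f ×
    ∃ λ κ → ∀ {i j} → i Fin.< j → c (f i) (f j) ≡ κ
  ramsey q m with pigeonhole q m
  ... | M , select with endHomogeneous q M
  ...   | N , end = N , go
    where
    go : (c : Fin N → Fin N → Fin q) →
         ∃ λ (f : Fin m → Fin N) → Increasing f ×
         ∃ λ κ → ∀ {i j} → i Fin.< j → c (f i) (f j) ≡ κ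
    go c with end c
    ... | f , f↑ , κ , hom with select κ
    ...   | κ₀ , g , g↑ , const = f ∘ g , f↑ ∘ g↑ , κ₀ , λ {i} i<j → trans (hom (g↑ i<j)) (const i)

  -- Product Ramsey theorem for pairs.

  map-∘-⊛ : ∀ {A B C : Set} {k} (φ : B → C) (fs : Vec (A → B) k) (xs : Vec A k) →
            map (φ ∘_) fs ⊛ xs ≡ map φ (fs ⊛ xs)
  map-∘-⊛ φ []       []       = refl
  map-∘-⊛ φ (f ∷ fs) (x ∷ xs) = cong (φ (f x) ∷_) (map-∘-⊛ φ fs xs)

  infix 4 _<ᵥ_
  _<ᵥ_ : ∀ {m k} → Rel (Vec (Fin m) k) 0ℓ
  _<ᵥ_ = Pointwise Fin._<_

  -- The first coordinate is absorbed into the colour: a pair of points in the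
  -- remaining coordinates is coloured by a function on pairs of first coordinates.
  productRamsey : ∀ k q m → ∃ λ N → (c : Vec (Fin N) k → Vec (Fin N) k → Fin q) →
    ∃ λ (f : Vec (Fin m → Fin N) k) → All (Injective _≡_ _≡_) f ×
    ∃ λ κ → ∀ {x y} → x <ᵥ y → c (f ⊛ x) (f ⊛ y) ≡ κ
  productRamsey zero    q m = 0 , λ c → [] , [] , c [] [] , λ { [] → refl }
  -- `M` comes first: there are `(q ^ M) ^ M` functions on pairs from `Fin M`, and this is the
  -- number of colours for the remaining coordinates.
  productRamsey (suc k) q m with ramsey q m
  ... | M , ram with productRamsey k ((q ^ M) ^ M) m
  -- All coordinates need a common range: the first one uses the lower `M` values, the others the
  -- upper `N`.
  ...   | N , ih = M + N , go
    where
    go : (c : Vec (Fin (M + N)) (suc k) → Vec (Fin (M + N)) (suc k) → Fin q) →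
         ∃ λ (f : Vec (Fin m → Fin (M + N)) (suc k)) → All (Injective _≡_ _≡_) f ×
         ∃ λ κ → ∀ {x y} → x <ᵥ y → c (f ⊛ x) (f ⊛ y) ≡ κ
    go c with ih (λ xs ys → funToFin λ a → funToFin λ b →
                   c ((a ↑ˡ N) ∷ map (M ↑ʳ_) xs) ((b ↑ˡ N) ∷ map (M ↑ʳ_) ys))
    ... | f , f-inj , κ , hom with ram (λ a b → finToFun (finToFun κ a) b)
    ...   | g , g↑ , κ₀ , hom₀ =
      ((_↑ˡ N) ∘ g) ∷ map ((M ↑ʳ_) ∘_) f ,
      (increasing⇒injective g↑ ∘ Fin.↑ˡ-injective N _ _)
        ∷ All.map⁺ (All.map {P = Injective _≡_ _≡_} (λ inj {_} {_} → inj ∘ Fin.↑ʳ-injective M _ _) f-inj) ,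
      κ₀ , const
      where
      const : ∀ {x y} → x <ᵥ y →
              c (((_↑ˡ N) ∘ g ∷ map ((M ↑ʳ_) ∘_) f) ⊛ x) (((_↑ˡ N) ∘ g ∷ map ((M ↑ʳ_) ∘_) f) ⊛ y) ≡ κ₀
      const {a ∷ xs} {b ∷ ys} (a<b ∷ xs<ys)
        rewrite map-∘-⊛ (M ↑ʳ_) f xs | map-∘-⊛ (M ↑ʳ_) f ys | sym (hom₀ a<b) | sym (hom xs<ys) =
        sym (trans (cong (λ κ′ → finToFun κ′ (g b)) (Fin.finToFun-funToFin _ (g a)))
                   (Fin.finToFun-funToFin _ (g b)))

  -- Equality patterns of a colouring on cubes.

  cubeSize : ℕ → ℕ → ℕ
  cubeSize zero    q = q
  cubeSize (suc k) q = cubeSize k q * cubeSize k q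

  -- The codes of the two halves of the cube are paired, so `cubeSize k q` is `q` to the power
  -- `2 ^ k`, the number of functions on the cube.
  encode : ∀ k {q} → (Vec Bool k → Fin q) → Fin (cubeSize k q)
  encode zero    φ = φ []
  encode (suc k) φ = combine (encode k (φ ∘ (true ∷_))) (encode k (φ ∘ (false ∷_)))

  encode-injective : ∀ k {q} {φ ψ : Vec Bool k → Fin q} → encode k φ ≡ encode k ψ → ∀ s → φ s ≡ ψ s
  encode-injective zero    eq []          = eq
  encode-injective (suc k) {φ = φ} {ψ} eq (true ∷ s) = encode-injective k (Fin.combine-injectiveˡ
    (encode k (φ ∘ (true ∷_))) _ (encode k (ψ ∘ (true ∷_))) _ eq) s
  encode-injective (suc k) {φ = φ} {ψ} eq (false ∷ s) = encode-injective k (Fin.combine-injectiveʳ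
    (encode k (φ ∘ (true ∷_))) _ (encode k (ψ ∘ (true ∷_))) _ eq) s

  ⟦_⟧ : ∀ {A : Set} → Dec A → Fin 2
  ⟦ yes _ ⟧ = 1F
  ⟦ no  _ ⟧ = 0F

  ⟦⟧-transfer : ∀ {A B : Set} (a? : Dec A) (b? : Dec B) → ⟦ a? ⟧ ≡ ⟦ b? ⟧ → A → B
  ⟦⟧-transfer _       (yes b) _  _ = b
  ⟦⟧-transfer (no ¬a) (no _)  _  a = contradiction a ¬a
  ⟦⟧-transfer (yes _) (no _)  () _

  vertex : ∀ {A : Set} {k} → Vec A k → Vec A k → Vec Bool k → Vec A k
  vertex []       []       []      = []
  vertex (x ∷ xs) (y ∷ ys) (b ∷ s) = (if b then y else x) ∷ vertex xs ys s

  ⊛-vertex : ∀ {A B : Set} {k} (f : Vec (A → B) k) xs ys s →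
             f ⊛ vertex xs ys s ≡ vertex (f ⊛ xs) (f ⊛ ys) s
  ⊛-vertex []      []       []       []      = refl
  ⊛-vertex (f ∷ fs) (x ∷ xs) (y ∷ ys) (b ∷ s) = cong₂ _∷_ (Bool.if-float f b) (⊛-vertex fs xs ys s)

  module _ {m k r} (c : Vec (Fin m) k → Fin r) where

    -- Only coincidences between colours are recorded, not the colours. Hence the number of codes
    -- depends on `k` alone, which is what makes `N` independent of `r`.
    pattern-code : Vec (Fin m) k → Vec (Fin m) k → Fin (cubeSize k (cubeSize k 2))
    pattern-code x y = encode k λ s → encode k λ s′ → ⟦ c (vertex x y s) Fin.≟ c (vertex x y s′) ⟧

    pattern-transfer : ∀ {x y x′ y′} → pattern-code x y ≡ pattern-code x′ y′ → ∀ s s′ →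
      c (vertex x y s) ≡ c (vertex x y s′) → c (vertex x′ y′ s) ≡ c (vertex x′ y′ s′)
    pattern-transfer eq s s′ = ⟦⟧-transfer (_ Fin.≟ _) (_ Fin.≟ _)
      (encode-injective k (encode-injective k eq s) s′)

    -- An implication suffices: exchanging the two cubes gives the converse, so all cubes show the
    -- same equality pattern.
    CubeHomogeneous : Set
    CubeHomogeneous = ∀ {x y x′ y′} → x <ᵥ y → x′ <ᵥ y′ → ∀ s s′ →
      c (vertex x y s) ≡ c (vertex x y s′) → c (vertex x′ y′ s) ≡ c (vertex x′ y′ s′)

  cubeHomogeneous : ∀ k m → ∃ λ N → ∀ {r} (c : Vec (Fin N) k → Fin r) →
    ∃ λ (f : Vec (Fin m → Fin N) k) → All (Injective _≡_ _≡_) f × CubeHomogeneous (c ∘ (f ⊛_))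
  cubeHomogeneous k m with productRamsey k (cubeSize k (cubeSize k 2)) m
  ... | N , ram = N , go
    where
    go : ∀ {r} (c : Vec (Fin N) k → Fin r) →
         ∃ λ (f : Vec (Fin m → Fin N) k) → All (Injective _≡_ _≡_) f × CubeHomogeneous (c ∘ (f ⊛_))
    go c with ram (pattern-code c)
    ... | f , f-inj , κ , hom = f , f-inj , λ {x} {y} {x′} {y′} → transfer
      where
      transfer : CubeHomogeneous (c ∘ (f ⊛_))
      transfer {x} {y} {x′} {y′} x<y x′<y′ s s′ eq
        rewrite ⊛-vertex f x y s | ⊛-vertex f x y s′ | ⊛-vertex f x′ y′ s | ⊛-vertex f x′ y′ s′ =
        pattern-transfer c (trans (hom x<y) (sym (hom x′<y′))) s s′ eq

  -- From homogeneous cubes to canonical colourings.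

  Agree : ∀ {k} → Vec Bool k → Vec Bool k → Vec Bool k → Set
  Agree I s s′ = ∀ t → lookup I t ≡ true → lookup s t ≡ lookup s′ t

  ∅ : ∀ {k} → Vec Bool k
  ∅ = replicate _ false

  ⁅_⁆ : ∀ {k} → Fin k → Vec Bool k
  ⁅ t ⁆ = ∅ [ t ]≔ true

  vertex-∅ : ∀ {A : Set} {k} (x y : Vec A k) → vertex x y ∅ ≡ x
  vertex-∅ []       []       = refl
  vertex-∅ (x ∷ xs) (y ∷ ys) = cong (x ∷_) (vertex-∅ xs ys)

  vertex-⁅⁆ : ∀ {A : Set} {k} (x y : Vec A k) t → vertex x y ⁅ t ⁆ ≡ x [ t ]≔ lookup y t
  vertex-⁅⁆ (x ∷ xs) (y ∷ ys) zero    = cong (y ∷_) (vertex-∅ xs ys)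
  vertex-⁅⁆ (x ∷ xs) (y ∷ ys) (suc t) = cong (x ∷_) (vertex-⁅⁆ xs ys t)

  vertex-update-low : ∀ {A : Set} {k} (x y : Vec A k) {a} s t → lookup s t ≡ false →
                      vertex x (y [ t ]≔ a) s ≡ vertex x y s
  vertex-update-low (x ∷ xs) (y ∷ ys) (false ∷ s) zero    _  = refl
  vertex-update-low (x ∷ xs) (y ∷ ys) (b ∷ s)     (suc t) eq = cong (_ ∷_) (vertex-update-low xs ys s t eq)

  vertex-update-high : ∀ {A : Set} {k} (x y : Vec A k) {a} s t → lookup s t ≡ true →
                       vertex x (y [ t ]≔ a) s ≡ vertex x y s [ t ]≔ a
  vertex-update-high (x ∷ xs) (y ∷ ys) (true ∷ s) zero    _  = refl
  vertex-update-high (x ∷ xs) (y ∷ ys) (b ∷ s)    (suc t) eq = cong (_ ∷_) (vertex-update-high xs ys s t eq)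

  vertex-overwrite : ∀ {A : Set} {k} (x y : Vec A k) {a b} s t →
                     vertex x y (s [ t ]≔ b) [ t ]≔ a ≡ vertex x y s [ t ]≔ a
  vertex-overwrite (x ∷ xs) (y ∷ ys) (_ ∷ s) zero    = refl
  vertex-overwrite (x ∷ xs) (y ∷ ys) (_ ∷ s) (suc t) = cong (_ ∷_) (vertex-overwrite xs ys s t)

  -- `s` is turned into `s′` one coordinate at a time: coordinates in `I` agree already, the others
  -- may be changed freely.
  update-invariant⇒agree-invariant : ∀ {C : Set} {k} (c : Vec Bool k → C) (I : Vec Bool k) →
    (∀ t → lookup I t ≡ false → ∀ s b b′ → c (s [ t ]≔ b) ≡ c (s [ t ]≔ b′)) →
    ∀ s s′ → Agree I s s′ → c s ≡ c s′
  update-invariant⇒agree-invariant c []      inv []      []       agree = refl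
  update-invariant⇒agree-invariant c (i ∷ I) inv (x ∷ s) (y ∷ s′) agree =
    trans (update-invariant⇒agree-invariant (c ∘ (x ∷_)) I
            (λ t t∉I s₁ → inv (suc t) t∉I (x ∷ s₁)) s s′ (agree ∘ suc))
          (head-step i refl)
    where
    -- The copy `j` of `i` keeps the equation with `i` available after the case split.
    head-step : ∀ j → j ≡ i → c (x ∷ s′) ≡ c (y ∷ s′)
    head-step true  j≡i = cong (λ b → c (b ∷ s′)) (agree zero (sym j≡i))
    head-step false j≡i = inv zero (sym j≡i) (x ∷ s′) x y

  bit : Bool → Fin 3
  bit b = if b then 1F else 0F

  Canonical : ∀ {k r} → (Vec Bool k → Fin r) → Vec Bool k → Set
  Canonical c I = ∀ s s′ → (Agree I s s′ → c s ≡ c s′) × (c s ≡ c s′ → Agree I s s′)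

  zeros ones twos : ∀ {k} → Vec (Fin 3) k
  zeros = replicate _ 0F
  ones  = replicate _ 1F
  twos  = replicate _ 2F

  point : ∀ {k} → Vec Bool k → Vec (Fin 3) k
  point = vertex zeros ones

  zeros<ones : ∀ {k} → (zeros {k}) <ᵥ ones
  zeros<ones {zero}  = []
  zeros<ones {suc k} = s≤s z≤n ∷ zeros<ones

  zeros<ones[]≔2 : ∀ {k} t → (zeros {k}) <ᵥ (ones [ t ]≔ 2F)
  zeros<ones[]≔2 zero    = s≤s z≤n ∷ zeros<ones
  zeros<ones[]≔2 (suc t) = s≤s z≤n ∷ zeros<ones[]≔2 t

  point<twos : ∀ {k} (s : Vec Bool k) → (point s) <ᵥ twos
  point<twos []          = []
  point<twos (true ∷ s)  = s≤s (s≤s z≤n) ∷ point<twos s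
  point<twos (false ∷ s) = s≤s z≤n ∷ point<twos s

  vertex-twos : ∀ {k} (x : Vec (Fin 3) k) t → vertex x twos ⁅ t ⁆ ≡ x [ t ]≔ 2F
  vertex-twos x t = trans (vertex-⁅⁆ x twos t) (cong (x [ t ]≔_) (lookup-replicate t 2F))

  -- The third value 2 of each coordinate lies above both 0 and 1, so that moving
  -- a single coordinate up to 2 can be compared with the cube {0,1}ᵏ.
  module _ {k r} (c : Vec (Fin 3) k → Fin r) (hom : CubeHomogeneous c) where

    -- One test, raising `t` from the lowest vertex, decides for all vertices, because all cubes
    -- show the same pattern.
    essential : Vec Bool k
    essential = tabulate λ t → not (does (c (point ∅) Fin.≟ c (point ⁅ t ⁆)))

    inessential⇒≡ : ∀ t → lookup essential t ≡ false → c (point ∅) ≡ c (point ⁅ t ⁆)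
    inessential⇒≡ t eq rewrite lookup∘tabulate (λ t → not (does (c (point ∅) Fin.≟ c (point ⁅ t ⁆)))) t
      with c (point ∅) Fin.≟ c (point ⁅ t ⁆)
    ... | yes p = p

    essential⇒≢ : ∀ t → lookup essential t ≡ true → c (point ∅) ≢ c (point ⁅ t ⁆)
    essential⇒≢ t eq rewrite lookup∘tabulate (λ t → not (does (c (point ∅) Fin.≟ c (point ⁅ t ⁆)))) t
      with c (point ∅) Fin.≟ c (point ⁅ t ⁆)
    ... | no ¬p = ¬p

    -- In the cube from `point s` to `twos`, the vertices `∅` and `⁅ t ⁆` are `point s` and
    -- `point s` with `t` raised to 2. Homogeneity transfers the test for `t` to them.
    raise-inessential : ∀ t → lookup essential t ≡ false → ∀ s → c (point s) ≡ c (point s [ t ]≔ 2F)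
    raise-inessential t t∉I s =
      subst₂ (λ x y → c x ≡ c y) (vertex-∅ (point s) twos) (vertex-twos (point s) t)
        (hom zeros<ones (point<twos s) ∅ ⁅ t ⁆ (inessential⇒≡ t t∉I))

    raise-essential : ∀ t → lookup essential t ≡ true → ∀ s → c (point s) ≢ c (point s [ t ]≔ 2F)
    raise-essential t t∈I s eq = essential⇒≢ t t∈I
      (hom (point<twos s) zeros<ones ∅ ⁅ t ⁆
        (subst₂ (λ x y → c x ≡ c y) (sym (vertex-∅ (point s) twos)) (sym (vertex-twos (point s) t)) eq))

    -- Raising `t` to 2 erases the difference between `b` and `b′`.
    update-inessential : ∀ t → lookup essential t ≡ false → ∀ s b b′ →
                         c (point (s [ t ]≔ b)) ≡ c (point (s [ t ]≔ b′))
    update-inessential t t∉I s b b′ = begin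
      c (point (s [ t ]≔ b))             ≡⟨ raise-inessential t t∉I (s [ t ]≔ b) ⟩
      c (point (s [ t ]≔ b) [ t ]≔ 2F)   ≡⟨ cong c (vertex-overwrite zeros ones s t) ⟩
      c (point s [ t ]≔ 2F)              ≡⟨ cong c (vertex-overwrite zeros ones s t) ⟨
      c (point (s [ t ]≔ b′) [ t ]≔ 2F)  ≡⟨ raise-inessential t t∉I (s [ t ]≔ b′) ⟨
      c (point (s [ t ]≔ b′))            ∎
      where open ≡-Reasoning

    -- If the colours were equal, they would also be equal in the cube whose top has 2 at `t`. There
    -- `s`, being low at `t`, gives the same point as before, while `s′` gives `point s′` raised at
    -- `t`; so raising `t` would preserve the colour, against `raise-essential`.
    essential-separates : ∀ t → lookup essential t ≡ true → ∀ s s′ →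
      lookup s t ≡ false → lookup s′ t ≡ true → c (point s) ≢ c (point s′)
    essential-separates t t∈I s s′ s∌t s′∋t eq = raise-essential t t∈I s′ (begin
      c (point s′)                           ≡⟨ eq ⟨
      c (point s)                            ≡⟨ cong c (vertex-update-low zeros ones s t s∌t) ⟨
      c (vertex zeros (ones [ t ]≔ 2F) s)    ≡⟨ hom zeros<ones (zeros<ones[]≔2 t) s s′ eq ⟩
      c (vertex zeros (ones [ t ]≔ 2F) s′)   ≡⟨ cong c (vertex-update-high zeros ones s′ t s′∋t) ⟩
      c (point s′ [ t ]≔ 2F)                 ∎)
      where open ≡-Reasoning

    essential-canonical : Canonical (c ∘ point) essential
    essential-canonical s s′ =
      update-invariant⇒agree-invariant (c ∘ point) essential update-inessential s s′ , agree
      where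
      agree : c (point s) ≡ c (point s′) → Agree essential s s′
      agree eq t t∈I with lookup s t in s-t | lookup s′ t in s′-t
      ... | true  | true  = refl
      ... | false | false = refl
      ... | false | true  = contradiction eq (essential-separates t t∈I s s′ s-t s′-t)
      ... | true  | false = contradiction (sym eq) (essential-separates t t∈I s′ s s′-t s-t)

  ⊛-point : ∀ {A : Set} {k} (f : Vec (Fin 3 → A) k) s → map (_∘ bit) f ⊛ s ≡ f ⊛ point s
  ⊛-point []      []      = refl
  ⊛-point (f ∷ fs) (b ∷ s) = cong (f (bit b) ∷_) (⊛-point fs s)

  -- Only two values per coordinate are kept. That they differ makes them two distinct vertices of a
  -- simplex later on.
  HasCanonicalCubes : ℕ → ℕ → Set
  HasCanonicalCubes k N = ∀ {r} (c : Vec (Fin N) k → Fin r) →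
    ∃ λ (f : Vec (Bool → Fin N) k) → All (λ g → g false ≢ g true) f ×
    ∃ λ I → Canonical (c ∘ (f ⊛_)) I

  canonicalRamsey : ∀ k → ∃ λ N → HasCanonicalCubes k N
  -- Three values per coordinate: 0 and 1 for the cube, 2 for the comparisons.
  canonicalRamsey k with cubeHomogeneous k 3
  ... | N , cube = N , go
    where
    go : HasCanonicalCubes k N
    go c with cube c
    ... | f , f-inj , hom =
      map (_∘ bit) f ,
      All.map⁺ (All.map {P = Injective _≡_ _≡_} (λ inj eq → contradiction (inj eq) λ ()) f-inj) ,
      essential (c ∘ (f ⊛_)) hom , canonical
      where
      canonical : Canonical (c ∘ (map (_∘ bit) f ⊛_)) (essential (c ∘ (f ⊛_)) hom)
      canonical s s′ rewrite ⊛-point f s | ⊛-point f s′ = essential-canonical (c ∘ (f ⊛_)) hom s s′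

open BoxRamsey using (Agree; HasCanonicalCubes; canonicalRamsey)

-- Ordered field arithmetic, the Archimedean property and square roots.

module OrderedField (em : ExcludedMiddle 0ℓ) (ℝ : CompleteOrderedField) where

  open CompleteOrderedField ℝ
  open IsTotalOrder isTotalOrder public
    using (total; antisym; isPartialOrder)
    renaming (refl to ≤-refl; trans to ≤-trans; reflexive to ≤-reflexive)
  open Algebra.Properties.Semiring.Mult semiring using (×-congʳ; ×-assoc-*) renaming (_×_ to _·_)
  open Algebra.Solver.Ring.NaturalCoefficients.Default commutativeSemiring using (solve; _:=_; _:+_; _:*_; con)

  poset : Poset 0ℓ 0ℓ 0ℓ
  poset = record { isPartialOrder = isPartialOrder }

  open Relation.Binary.Reasoning.PartialOrder poset

  x≤x+d : ∀ {x d} → 0# ≤ d → x ≤ x + d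
  x≤x+d {x} {d} 0≤d = begin
    x       ≈⟨ +-identityˡ x ⟨
    0# + x  ≤⟨ +-monoˡ-≤ x 0≤d ⟩
    d + x   ≈⟨ +-comm d x ⟩
    x + d   ∎

  +-cancelʳ-≤ : ∀ z {x y} → x + z ≤ y + z → x ≤ y
  +-cancelʳ-≤ z {x} {y} x+z≤y+z = begin
    x            ≈⟨ x+z-z≈x x ⟨
    x + z - z    ≤⟨ +-monoˡ-≤ (- z) x+z≤y+z ⟩
    y + z - z    ≈⟨ x+z-z≈x y ⟩
    y            ∎
    where
    x+z-z≈x : ∀ x → x + z - z ≈ x
    x+z-z≈x x = trans (+-assoc x z (- z)) (trans (+-congˡ (-‿inverseʳ z)) (+-identityʳ x))

  ≤⇒difference : ∀ {x y} → x ≤ y → ∃ λ d → 0# ≤ d × x + d ≈ y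
  ≤⇒difference {x} {y} x≤y = y - x ,
    (begin
      0#     ≈⟨ -‿inverseʳ x ⟨
      x - x  ≤⟨ +-monoˡ-≤ (- x) x≤y ⟩
      y - x  ∎) ,
    (begin-equality
      x + (y - x)  ≈⟨ +-comm x (y - x) ⟩
      y - x + x    ≈⟨ +-assoc y (- x) x ⟩
      y + (- x + x) ≈⟨ +-congˡ (-‿inverseˡ x) ⟩
      y + 0#       ≈⟨ +-identityʳ y ⟩
      y            ∎)

  +-nonNeg : ∀ {x y} → 0# ≤ x → 0# ≤ y → 0# ≤ x + y
  +-nonNeg 0≤x 0≤y = ≤-trans 0≤x (x≤x+d 0≤y)

  +-monoʳ-≤ : ∀ z {x y} → x ≤ y → z + x ≤ z + y
  +-monoʳ-≤ z {x} {y} x≤y = begin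
    z + x  ≈⟨ +-comm z x ⟩
    x + z  ≤⟨ +-monoˡ-≤ z x≤y ⟩
    y + z  ≈⟨ +-comm y z ⟩
    z + y  ∎

  *-monoˡ-≤ : ∀ {z x y} → 0# ≤ z → x ≤ y → z * x ≤ z * y
  *-monoˡ-≤ {z} {x} {y} 0≤z x≤y with ≤⇒difference x≤y
  ... | d , 0≤d , x+d≈y = begin
    z * x          ≤⟨ x≤x+d (*-nonNeg 0≤z 0≤d) ⟩
    z * x + z * d  ≈⟨ distribˡ z x d ⟨
    z * (x + d)    ≈⟨ *-congˡ x+d≈y ⟩
    z * y          ∎

  -- The difference of the two sides is a square.
  am-gm : ∀ x y → (x + x) * y ≤ x * x + y * y
  am-gm x y with total x y
  ... | inj₁ x≤y with d , 0≤d , x+d≈y ← ≤⇒difference x≤y = begin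
    (x + x) * y                        ≈⟨ *-congˡ x+d≈y ⟨
    (x + x) * (x + d)                  ≤⟨ x≤x+d (*-nonNeg 0≤d 0≤d) ⟩
    (x + x) * (x + d) + d * d
      ≈⟨ solve 2 (λ x d → (x :+ x) :* (x :+ d) :+ d :* d := x :* x :+ (x :+ d) :* (x :+ d))
           refl x d ⟩
    x * x + (x + d) * (x + d)          ≈⟨ +-congˡ (*-cong x+d≈y x+d≈y) ⟩
    x * x + y * y                      ∎
  am-gm x y | inj₂ y≤x with d , 0≤d , y+d≈x ← ≤⇒difference y≤x = begin
    (x + x) * y                        ≈⟨ *-congʳ (+-cong y+d≈x y+d≈x) ⟨
    (y + d + (y + d)) * y              ≤⟨ x≤x+d (*-nonNeg 0≤d 0≤d) ⟩
    (y + d + (y + d)) * y + d * d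
      ≈⟨ solve 2 (λ y d → (y :+ d :+ (y :+ d)) :* y :+ d :* d := (y :+ d) :* (y :+ d) :+ y :* y)
           refl y d ⟩
    (y + d) * (y + d) + y * y          ≈⟨ +-congʳ (*-cong y+d≈x y+d≈x) ⟩
    x * x + y * y                      ∎

  square-nonNeg : ∀ x → 0# ≤ x * x
  square-nonNeg x = begin
    0#              ≈⟨ zeroʳ (x + x) ⟨
    (x + x) * 0#    ≤⟨ am-gm x 0# ⟩
    x * x + 0# * 0# ≈⟨ trans (+-congˡ (zeroˡ 0#)) (+-identityʳ _) ⟩
    x * x           ∎

  0≤1 : 0# ≤ 1#
  0≤1 = ≤-trans (square-nonNeg 1#) (≤-reflexive (*-identityʳ 1#))

  sum≈0⇒≈0 : ∀ {x y} → 0# ≤ x → 0# ≤ y → x + y ≈ 0# → x ≈ 0#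
  sum≈0⇒≈0 0≤x 0≤y x+y≈0 = antisym (≤-trans (x≤x+d 0≤y) (≤-reflexive x+y≈0)) 0≤x

  1+x≉0 : ∀ {x} → 0# ≤ x → ¬ (1# + x ≈ 0#)
  1+x≉0 0≤x eq = 1≉0 (sum≈0⇒≈0 0≤1 0≤x eq)

  inverse-nonNeg : ∀ {x y} → 0# ≤ x → x * y ≈ 1# → 0# ≤ y
  inverse-nonNeg {x} {y} 0≤x xy≈1 = begin
    0#           ≤⟨ *-nonNeg 0≤x (square-nonNeg y) ⟩
    x * (y * y)  ≈⟨ *-assoc x y y ⟨
    x * y * y    ≈⟨ *-congʳ xy≈1 ⟩
    1# * y       ≈⟨ *-identityˡ y ⟩
    y            ∎

  divide : ∀ {x} y → ¬ (x ≈ 0#) → 0# ≤ x → 0# ≤ y → ∃ λ z → 0# ≤ z × x * z ≈ y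
  divide {x} y x≉0 0≤x 0≤y with inverse x x≉0
  ... | r , xr≈1 = r * y , *-nonNeg (inverse-nonNeg 0≤x xr≈1) 0≤y ,
    trans (sym (*-assoc x r y)) (trans (*-congʳ xr≈1) (*-identityˡ y))

  *-cancelˡ-≤ : ∀ {z x y} → ¬ (z ≈ 0#) → 0# ≤ z → z * x ≤ z * y → x ≤ y
  *-cancelˡ-≤ {z} {x} {y} z≉0 0≤z zx≤zy with inverse z z≉0
  ... | r , zr≈1 = begin
    x            ≈⟨ r*[z*x]≈x x ⟨
    r * (z * x)  ≤⟨ *-monoˡ-≤ (inverse-nonNeg 0≤z zr≈1) zx≤zy ⟩
    r * (z * y)  ≈⟨ r*[z*x]≈x y ⟩
    y            ∎
    where
    r*[z*x]≈x : ∀ x → r * (z * x) ≈ x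
    r*[z*x]≈x x = trans (sym (*-assoc r z x))
      (trans (*-congʳ (trans (*-comm r z) zr≈1)) (*-identityˡ x))

  x≤[1+x]² : ∀ {w} → 0# ≤ w → w ≤ (1# + w) * (1# + w)
  x≤[1+x]² {w} 0≤w = begin
    w                                 ≤⟨ x≤x+d (+-nonNeg (+-nonNeg 0≤1 0≤w) (*-nonNeg 0≤w 0≤w)) ⟩
    w + (1# + w + w * w)
      ≈⟨ solve 1 (λ w → w :+ (con 1 :+ w :+ w :* w) := (con 1 :+ w) :* (con 1 :+ w))
           refl w ⟩
    (1# + w) * (1# + w)               ∎

  ·-nonNeg : ∀ n {x} → 0# ≤ x → 0# ≤ n · x
  ·-nonNeg zero    0≤x = ≤-refl
  ·-nonNeg (suc n) 0≤x = +-nonNeg 0≤x (·-nonNeg n 0≤x)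

  -- If `b` bounded all multiples of `a`, they would have a supremum `s`. Adding `a` to a multiple
  -- gives a multiple, so `s - a` would be an upper bound too, forcing `a ≤ 0#`.
  archimedean : ∀ {a} b → 0# ≤ a → ¬ (a ≈ 0#) → ∃ λ n → b ≤ n · a
  archimedean {a} b 0≤a a≉0 with em {∃ λ n → b ≤ n · a}
  ... | yes bounded = bounded
  ... | no unbounded
    with supremum (λ y → ∃ λ n → y ≈ n · a) (0# , 0 , refl) (b , below)
    where
    below : UpperBound (λ y → ∃ λ n → y ≈ n · a) b
    below y (n , y≈na) with total b (n · a)
    ... | inj₁ b≤na = contradiction (n , b≤na) unbounded
    ... | inj₂ na≤b = ≤-trans (≤-reflexive y≈na) na≤b
  ...   | s , upper , least = contradiction (antisym a≤0 0≤a) a≉0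
    where
    s≤s-a : s ≤ s - a
    s≤s-a = least (s - a) λ { y (n , y≈na) → +-cancelʳ-≤ a (begin
      y + a        ≈⟨ +-congʳ y≈na ⟩
      n · a + a    ≈⟨ +-comm (n · a) a ⟩
      suc n · a    ≤⟨ upper _ (suc n , refl) ⟩
      s            ≈⟨ +-identityʳ s ⟨
      s + 0#       ≈⟨ +-congˡ (-‿inverseˡ a) ⟨
      s + (- a + a) ≈⟨ +-assoc s (- a) a ⟨
      s - a + a    ∎) }
    a≤0 : a ≤ 0#
    a≤0 = +-cancelʳ-≤ (s - a) (begin
      a + (s - a)    ≈⟨ +-comm a (s - a) ⟩
      s - a + a      ≈⟨ +-assoc s (- a) a ⟩
      s + (- a + a)  ≈⟨ +-congˡ (-‿inverseˡ a) ⟩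
      s + 0#         ≈⟨ +-identityʳ s ⟩
      s              ≤⟨ s≤s-a ⟩
      s - a          ≈⟨ +-identityˡ (s - a) ⟨
      0# + (s - a)   ∎)

  equalParts : ∀ {a b} → 0# ≤ a → ¬ (a ≈ 0#) → 0# ≤ b →
               ∃ λ n → ∃ λ x → 0# ≤ x × x ≤ a × n · x ≈ b
  equalParts {a} {b} 0≤a a≉0 0≤b with archimedean b 0≤a a≉0
  -- There are `suc n` parts, so that the divisor is non-zero even if `n` is zero; `b ≤ suc n · a`
  -- still holds and bounds each part by `a`.
  ... | n , b≤na with divide b (1+x≉0 (·-nonNeg n 0≤1)) (·-nonNeg (suc n) 0≤1) 0≤b
  ...   | x , 0≤x , Nx≈b =
    suc n , x , 0≤x ,
    *-cancelˡ-≤ (1+x≉0 (·-nonNeg n 0≤1)) (·-nonNeg (suc n) 0≤1) (begin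
      (suc n · 1#) * x  ≈⟨ Nx≈b ⟩
      b                 ≤⟨ b≤na ⟩
      n · a             ≤⟨ x≤x+d 0≤a ⟩
      n · a + a         ≈⟨ +-comm (n · a) a ⟩
      suc n · a         ≈⟨ ·1* (suc n) a ⟨
      (suc n · 1#) * a  ∎) ,
    trans (sym (·1* (suc n) x)) Nx≈b
    where
    ·1* : ∀ n x → (n · 1#) * x ≈ n · x
    ·1* n x = trans (×-assoc-* n 1# x) (×-congʳ n (*-identityˡ x))

  square≈0 : ∀ {x} → x * x ≈ 0# → x ≈ 0#
  square≈0 {x} x²≈0 with em {x ≈ 0#}
  ... | yes x≈0 = x≈0
  ... | no  x≉0 = let r , xr≈1 = inverse x x≉0 in begin-equality
    x            ≈⟨ *-identityʳ x ⟨
    x * 1#       ≈⟨ *-congˡ xr≈1 ⟨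
    x * (x * r)  ≈⟨ *-assoc x x r ⟨
    x * x * r    ≈⟨ *-congʳ x²≈0 ⟩
    0# * r       ≈⟨ zeroˡ r ⟩
    0#           ∎

  square-cancel-≤ : ∀ {x y} → 0# ≤ y → x * x ≤ y * y → x ≤ y
  square-cancel-≤ {x} {y} 0≤y x²≤y² with total x y
  ... | inj₁ x≤y = x≤y
  ... | inj₂ y≤x with em {x ≈ 0#}
  ...   | yes x≈0 = ≤-trans (≤-reflexive x≈0) 0≤y
  ...   | no  x≉0 = *-cancelˡ-≤ x≉0 0≤x (begin
    x * x  ≤⟨ x²≤y² ⟩
    y * y  ≤⟨ *-monoˡ-≤ 0≤y y≤x ⟩
    y * x  ≈⟨ *-comm y x ⟩
    x * y  ∎)
    where
    0≤x : 0# ≤ x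
    0≤x = ≤-trans 0≤y y≤x

  -- The root is the supremum of all `y` with `y * y ≤ w`, a set that contains `0#` and is bounded
  -- by `1# + w`.
  sqrt : ∀ {w} → 0# ≤ w → ∃ λ s → s * s ≈ w
  sqrt {w} 0≤w
    with supremum (λ y → y * y ≤ w) (0# , ≤-trans (≤-reflexive (zeroˡ 0#)) 0≤w)
           (1# + w , λ y y²≤w → square-cancel-≤ (+-nonNeg 0≤1 0≤w) (≤-trans y²≤w (x≤[1+x]² 0≤w)))
  ... | s , upper , least = s , antisym s²≤w w≤s²
    where
    0≤s : 0# ≤ s
    0≤s = upper 0# (≤-trans (≤-reflexive (zeroˡ 0#)) 0≤w)

    -- The Babylonian step t = (s² + w) / 2s is an upper bound, hence s ≤ t.
    s²≤w : s * s ≤ w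
    s²≤w with em {s ≈ 0#}
    ... | yes s≈0 = ≤-trans (≤-reflexive (trans (*-congʳ s≈0) (zeroˡ s))) 0≤w
    ... | no  s≉0
      with divide (s * s + w) (λ eq → s≉0 (sum≈0⇒≈0 0≤s 0≤s eq))
             (+-nonNeg 0≤s 0≤s) (+-nonNeg (square-nonNeg s) 0≤w)
    ...   | t , 0≤t , 2st≈s²+w = +-cancelʳ-≤ (s * s) (begin
      s * s + s * s  ≈⟨ distribʳ s s s ⟨
      (s + s) * s    ≤⟨ *-monoˡ-≤ (+-nonNeg 0≤s 0≤s) (least t t-upper) ⟩
      (s + s) * t    ≈⟨ 2st≈s²+w ⟩
      s * s + w      ≈⟨ +-comm (s * s) w ⟩
      w + s * s      ∎)
      where
      t-upper : UpperBound (λ y → y * y ≤ w) t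
      t-upper y y²≤w = *-cancelˡ-≤ (λ eq → s≉0 (sum≈0⇒≈0 0≤s 0≤s eq)) (+-nonNeg 0≤s 0≤s) (begin
        (s + s) * y    ≤⟨ am-gm s y ⟩
        s * s + y * y  ≤⟨ +-monoʳ-≤ (s * s) y²≤w ⟩
        s * s + w      ≈⟨ 2st≈s²+w ⟨
        (s + s) * t    ∎)

    -- With w = s² + d and e = d / (1 + 2s + d) ≤ 1 also (s + e)² ≤ w, so e ≤ 0.
    w≤s² : w ≤ s * s
    w≤s² with ≤⇒difference s²≤w
    ... | d , 0≤d , s²+d≈w
      with divide d (1+x≉0 (+-nonNeg (+-nonNeg 0≤s 0≤s) 0≤d))
             (+-nonNeg 0≤1 (+-nonNeg (+-nonNeg 0≤s 0≤s) 0≤d)) 0≤d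
    ...   | e , 0≤e , ke≈d = begin
      w          ≈⟨ s²+d≈w ⟨
      s * s + d  ≈⟨ +-congˡ (trans (sym ke≈d) (trans (*-congˡ e≈0) (zeroʳ _))) ⟩
      s * s + 0# ≈⟨ +-identityʳ (s * s) ⟩
      s * s      ∎
      where
      k = 1# + (s + s + d)
      0≤k : 0# ≤ k
      0≤k = +-nonNeg 0≤1 (+-nonNeg (+-nonNeg 0≤s 0≤s) 0≤d)
      e≤1 : e ≤ 1#
      e≤1 = *-cancelˡ-≤ (1+x≉0 (+-nonNeg (+-nonNeg 0≤s 0≤s) 0≤d)) 0≤k (begin
        k * e                ≈⟨ ke≈d ⟩
        d                    ≤⟨ x≤x+d (+-nonNeg 0≤1 (+-nonNeg 0≤s 0≤s)) ⟩
        d + (1# + (s + s))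
          ≈⟨ solve 2 (λ s d → d :+ (con 1 :+ (s :+ s)) := (con 1 :+ (s :+ s :+ d)) :* con 1)
               refl s d ⟩
        k * 1#               ∎)
      s+e≤s : s + e ≤ s
      s+e≤s = upper (s + e) (begin
        (s + e) * (s + e)
          ≈⟨ solve 2 (λ s e → (s :+ e) :* (s :+ e) := s :* s :+ ((s :+ s) :* e :+ e :* e))
               refl s e ⟩
        s * s + ((s + s) * e + e * e)       ≤⟨ +-monoʳ-≤ (s * s) (+-monoʳ-≤ ((s + s) * e) (*-monoˡ-≤ 0≤e e≤1)) ⟩
        -- The expression is now linear in `e`, and adding `d * e` completes the factor to `k`.
        s * s + ((s + s) * e + e * 1#)      ≤⟨ +-monoʳ-≤ (s * s) (x≤x+d (*-nonNeg 0≤d 0≤e)) ⟩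
        s * s + ((s + s) * e + e * 1# + d * e)
          ≈⟨ solve 3 (λ s d e → s :* s :+ ((s :+ s) :* e :+ e :* con 1 :+ d :* e) := s :* s :+ (con 1 :+ (s :+ s :+ d)) :* e)
               refl s d e ⟩
        s * s + k * e                       ≈⟨ +-congˡ ke≈d ⟩
        s * s + d                           ≈⟨ s²+d≈w ⟩
        w                                   ∎)
      e≈0 : e ≈ 0#
      e≈0 = antisym (+-cancelʳ-≤ s (begin
        e + s   ≈⟨ +-comm e s ⟩
        s + e   ≤⟨ s+e≤s ⟩
        s       ≈⟨ +-identityˡ s ⟨
        0# + s  ∎)) 0≤e

  -- Points at height `s` on two different axes have squared distance `s * s + s * s`; this scaling
  -- gives a simplex the squared edge length `w`.
  halfSqrt : ∀ {w} → 0# ≤ w → ∃ λ s → s * s + s * s ≈ w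
  halfSqrt {w} 0≤w =
    let v , 0≤v , 2v≈w = divide w (1+x≉0 0≤1) (+-nonNeg 0≤1 0≤1) 0≤w
        s , s²≈v       = sqrt 0≤v
    in s , (begin-equality
      s * s + s * s    ≈⟨ +-cong s²≈v s²≈v ⟩
      v + v            ≈⟨ +-cong (*-identityˡ v) (*-identityˡ v) ⟨
      1# * v + 1# * v  ≈⟨ distribʳ v 1# 1# ⟨
      (1# + 1#) * v    ≈⟨ 2v≈w ⟩
      w                ∎)

-- Labellings of the grid coordinates by the sides of a rectangle.

data Side : Set where
  horizontal vertical : Side

opposite : Side → Side
opposite horizontal = vertical
opposite vertical   = horizontal

-- Moving along a side of a rectangle in the grid changes exactly the
-- coordinates labelled by that side.
Labelling : ℕ → Set
Labelling = Vec (Maybe Side)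

_isOn_ : Maybe Side → Side → Bool
nothing           isOn _          = false
(just horizontal) isOn horizontal = true
(just horizontal) isOn vertical   = false
(just vertical)   isOn horizontal = false
(just vertical)   isOn vertical   = true

-- `κ` tells for each side whether its coordinates have been moved; unlabelled coordinates stay at
-- `false`.
vertexOf : ∀ {k} → Labelling k → (Side → Bool) → Vec Bool k
vertexOf L κ = map (maybe κ false) L

Seen : ∀ {k} → Vec Bool k → Labelling k → Side → Set
Seen I L s = ∃ λ t → lookup I t ≡ true × lookup L t ≡ just s

Unseen : ∀ {k} → Vec Bool k → Labelling k → Set
Unseen I L = ∀ t → lookup I t ≡ true → lookup L t ≡ nothing

Balanced : ∀ {k} → Vec Bool k → Labelling k → Set
Balanced I L = (∀ s → Seen I L s) ⊎ Unseen I L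

both : ∀ {P : Side → Set} → P horizontal → P vertical → ∀ s → P s
both p q horizontal = p
both p q vertical   = q

vertexOf-agree : ∀ {k} {I : Vec Bool k} {L} → Unseen I L → ∀ κ κ′ → Agree I (vertexOf L κ) (vertexOf L κ′)
vertexOf-agree {L = L} unseen κ κ′ t t∈I
  rewrite lookup-map t (maybe κ false) L | lookup-map t (maybe κ′ false) L | unseen t t∈I = ≡.refl

-- One coordinate of `I` labelled `s` reads off `κ s`. If both sides are seen, this separates all
-- four corners.
agree⇒≡ : ∀ {k} {I : Vec Bool k} {L s} → Seen I L s → ∀ κ κ′ →
          Agree I (vertexOf L κ) (vertexOf L κ′) → κ s ≡ κ′ s
agree⇒≡ {L = L} (t , t∈I , eq) κ κ′ agree with agree t t∈I
... | same rewrite lookup-map t (maybe κ false) L | lookup-map t (maybe κ′ false) L | eq = same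

-- `Balanced` treats the sides alike, so relabelling allows the horizontal side to be taken as the
-- shorter one.
opposite-balanced : ∀ {k} {I : Vec Bool k} {L} → Balanced I L → Balanced I (map (Maybe.map opposite) L)
opposite-balanced {I = I} {L} (inj₁ seen) = inj₁ (both (flip-seen (seen vertical)) (flip-seen (seen horizontal)))
  where
  flip-seen : ∀ {s} → Seen I L s → Seen I (map (Maybe.map opposite) L) (opposite s)
  flip-seen (t , t∈I , eq) = t , t∈I , ≡.trans (lookup-map t _ L) (≡.cong (Maybe.map opposite) eq)
opposite-balanced {L = L} (inj₂ unseen) =
  inj₂ λ t t∈I → ≡.trans (lookup-map t _ L) (≡.cong (Maybe.map opposite) (unseen t t∈I))

pattern o = nothing
pattern h = just horizontal
pattern v = just vertical

-- For a rectangle with squared sides a ≤ b the grid gets coordinates of weights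
-- a, a, β, z, x, …, x, where a + β = b, x + z = a and x + … + x = b.  The
-- constructors name the coordinates that make up the two sides.
data Decomposition {n} : Labelling (4 ℕ.+ n) → Set where
  a∣xs   : Decomposition (h ∷ o ∷ o ∷ o ∷ replicate n v)
  a′∣xs  : Decomposition (o ∷ h ∷ o ∷ o ∷ replicate n v)
  a∣a′β  : Decomposition (h ∷ v ∷ v ∷ o ∷ replicate n o)
  a′∣aβ  : Decomposition (v ∷ h ∷ v ∷ o ∷ replicate n o)
  zx∣a′β : ∀ i → Decomposition (o ∷ v ∷ v ∷ h ∷ (replicate n o [ i ]≔ h))

-- If `I` contains two of a, a′, β, they can be put on different sides by `a∣a′β` or `a′∣aβ`.
-- Otherwise, if `I` contains no x, one of a, a′ lies outside `I` and is unseen together with the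
-- xs. If `I` contains an x and exactly one of a, a′, that one is set against the xs. With an x but
-- neither a nor a′, the choice depends on β.
balancedDecomposition : ∀ {n} (I : Vec Bool (4 ℕ.+ n)) → ∃ λ L → Decomposition L × Balanced I L
balancedDecomposition (_ ∷ _ ∷ _ ∷ _ ∷ J) with Fin.any? (λ t → lookup J t Bool.≟ true)
balancedDecomposition (true ∷ true ∷ _ ∷ _ ∷ J) | _ =
  _ , a∣a′β , inj₁ (both (0F , ≡.refl , ≡.refl) (1F , ≡.refl , ≡.refl))
balancedDecomposition (true ∷ false ∷ true ∷ _ ∷ J) | _ =
  _ , a∣a′β , inj₁ (both (0F , ≡.refl , ≡.refl) (2F , ≡.refl , ≡.refl))
balancedDecomposition (false ∷ true ∷ true ∷ _ ∷ J) | _ =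
  _ , a′∣aβ , inj₁ (both (1F , ≡.refl , ≡.refl) (2F , ≡.refl , ≡.refl))
balancedDecomposition (true ∷ false ∷ false ∷ _ ∷ J) | yes (t , t∈J) =
  _ , a∣xs , inj₁ (both (0F , ≡.refl , ≡.refl) (suc (suc (suc (suc t))) , t∈J , lookup-replicate t v))
balancedDecomposition (false ∷ true ∷ false ∷ _ ∷ J) | yes (t , t∈J) =
  _ , a′∣xs , inj₁ (both (1F , ≡.refl , ≡.refl) (suc (suc (suc (suc t))) , t∈J , lookup-replicate t v))
balancedDecomposition (true ∷ false ∷ false ∷ _ ∷ J) | no J-empty = _ , a′∣xs , inj₂ λ
  { 0F _ → ≡.refl ; 2F _ → ≡.refl ; 3F _ → ≡.refl
  ; (suc (suc (suc (suc t)))) t∈J → contradiction (t , t∈J) J-empty }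
balancedDecomposition (false ∷ _ ∷ _ ∷ _ ∷ J) | no J-empty = _ , a∣xs , inj₂ λ
  { 1F _ → ≡.refl ; 2F _ → ≡.refl ; 3F _ → ≡.refl
  ; (suc (suc (suc (suc t)))) t∈J → contradiction (t , t∈J) J-empty }
-- Here z completes the x at `t` to the horizontal side, so that this x and β lie on different
-- sides.
balancedDecomposition {n} (false ∷ false ∷ true ∷ _ ∷ J) | yes (t , t∈J) =
  _ , zx∣a′β t ,
  inj₁ (both (suc (suc (suc (suc t))) , t∈J , lookup∘update t (replicate n o) h) (2F , ≡.refl , ≡.refl))
balancedDecomposition (false ∷ false ∷ false ∷ _ ∷ J) | yes _ = _ , a∣a′β , inj₂ λ
  { 3F _ → ≡.refl ; (suc (suc (suc (suc t)))) _ → lookup-replicate t o }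

-- The numbering follows the cyclic order in `Rectangle`: from 0F the horizontal side leads to 1F
-- and the vertical side to 3F.
corner : Fin 4 → Side → Bool
corner 0F = both false false
corner 1F = both true  false
corner 2F = both true  true
corner 3F = both false true

cornerAt : Bool → Bool → Fin 4
cornerAt false false = 0F
cornerAt true  false = 1F
cornerAt true  true  = 2F
cornerAt false true  = 3F

cornerAt-corner : ∀ i → cornerAt (corner i horizontal) (corner i vertical) ≡ i
cornerAt-corner 0F = ≡.refl
cornerAt-corner 1F = ≡.refl
cornerAt-corner 2F = ≡.refl
cornerAt-corner 3F = ≡.refl

corner-injective : ∀ {i j} → (∀ s → corner i s ≡ corner j s) → i ≡ j
corner-injective {i} {j} eq = ≡.trans (≡.sym (cornerAt-corner i))
  (≡.trans (≡.cong₂ cornerAt (eq horizontal) (eq vertical)) (cornerAt-corner j))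

-- Weights that represent both squared sides for every set of coordinates.

module Weights (em : ExcludedMiddle 0ℓ) (ℝ : CompleteOrderedField) where
  open CompleteOrderedField ℝ
  open OrderedField em ℝ
  open Algebra.Properties.Semiring.Mult semiring using () renaming (_×_ to _·_)

  gate : Bool → Carrier → Carrier
  gate true  x = x
  gate false x = 0#

  gate-cong : ∀ b {x y} → x ≈ y → gate b x ≈ gate b y
  gate-cong true  x≈y = x≈y
  gate-cong false _   = refl

  gate-0# : ∀ b → gate b 0# ≈ 0#
  gate-0# true  = refl
  gate-0# false = refl

  gate-+ : ∀ b x y → gate b (x + y) ≈ gate b x + gate b y
  gate-+ true  x y = refl
  gate-+ false x y = sym (+-identityˡ 0#)

  weight : ∀ {k} → Side → Labelling k → Vec Carrier k → Carrier
  weight s []      []       = 0#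
  weight s (l ∷ L) (w ∷ ws) = gate (l isOn s) w + weight s L ws

  weight-replicate : ∀ s n l x → weight s (replicate n l) (replicate n x) ≈ n · gate (l isOn s) x
  weight-replicate s zero    l x = refl
  weight-replicate s (suc n) l x = +-congˡ (weight-replicate s n l x)

  ·-zeroʳ : ∀ n → n · 0# ≈ 0#
  ·-zeroʳ zero    = refl
  ·-zeroʳ (suc n) = trans (+-identityˡ _) (·-zeroʳ n)

  weight-update : ∀ s l n x (i : Fin n) →
                  weight s (replicate n nothing [ i ]≔ l) (replicate n x) ≈ gate (l isOn s) x
  weight-update s l (suc n) x zero = trans
    (+-congˡ (trans (weight-replicate s n nothing x) (·-zeroʳ n))) (+-identityʳ _)
  weight-update s l (suc n) x (suc i) = trans (+-identityˡ _) (weight-update s l n x i)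

  weight-opposite : ∀ s {k} (L : Labelling k) ws →
                    weight s (map (Maybe.map opposite) L) ws ≈ weight (opposite s) L ws
  weight-opposite s []      []       = refl
  weight-opposite s (l ∷ L) (w ∷ ws) =
    +-cong (reflexive (≡.cong (λ b → gate b w) (isOn-opposite l s))) (weight-opposite s L ws)
    where
    isOn-opposite : ∀ l s → Maybe.map opposite l isOn s ≡ l isOn opposite s
    isOn-opposite nothing           horizontal = ≡.refl
    isOn-opposite nothing           vertical   = ≡.refl
    isOn-opposite (just horizontal) horizontal = ≡.refl
    isOn-opposite (just horizontal) vertical   = ≡.refl
    isOn-opposite (just vertical)   horizontal = ≡.refl
    isOn-opposite (just vertical)   vertical   = ≡.refl

  -- Quantified over all `I`, because the canonical theorem gives no control over the set that it
  -- returns.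
  Unavoidable : (Side → Carrier) → ∀ {k} → Vec Carrier k → Set
  Unavoidable ℓ ws = ∀ I → ∃ λ L → Balanced I L × (∀ s → weight s L ws ≈ ℓ s)

  decomposition-weight : ∀ {a b β z x n} → a + β ≈ b → x + z ≈ a → n · x ≈ b →
    ∀ {L} → Decomposition L → ∀ s → weight s L (a ∷ a ∷ β ∷ z ∷ replicate n x) ≈ both a b s
  decomposition-weight {a} {b} {β} {z} {x} {n} a+β≈b x+z≈a nx≈b = weigh
    where
    0+ : ∀ {x y} → x ≈ y → 0# + x ≈ y
    0+ = trans (+-identityˡ _)

    +0 : ∀ {x y} → y ≈ 0# → x + y ≈ x
    +0 y≈0 = trans (+-congˡ y≈0) (+-identityʳ _)

    none : ∀ s → weight s (replicate n o) (replicate n x) ≈ 0#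
    none s = trans (weight-replicate s n o x) (·-zeroʳ n)

    xs-horizontal : weight horizontal (replicate n v) (replicate n x) ≈ 0#
    xs-horizontal = trans (weight-replicate horizontal n v x) (·-zeroʳ n)

    xs-vertical : weight vertical (replicate n v) (replicate n x) ≈ b
    xs-vertical = trans (weight-replicate vertical n v x) nx≈b

    weigh : ∀ {L} → Decomposition L → ∀ s → weight s L (a ∷ a ∷ β ∷ z ∷ replicate n x) ≈ both a b s
    weigh a∣xs       horizontal = +0 (0+ (0+ (0+ xs-horizontal)))
    weigh a∣xs       vertical   = 0+ (0+ (0+ (0+ xs-vertical)))
    weigh a′∣xs      horizontal = 0+ (+0 (0+ (0+ xs-horizontal)))
    weigh a′∣xs      vertical   = 0+ (0+ (0+ (0+ xs-vertical)))
    weigh a∣a′β      horizontal = +0 (0+ (0+ (0+ (none horizontal))))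
    weigh a∣a′β      vertical   = 0+ (trans (+-congˡ (+0 (0+ (none vertical)))) a+β≈b)
    weigh a′∣aβ      horizontal = 0+ (+0 (0+ (0+ (none horizontal))))
    weigh a′∣aβ      vertical   = trans (+-congˡ (0+ (+0 (0+ (none vertical))))) a+β≈b
    weigh (zx∣a′β i) horizontal =
      0+ (0+ (0+ (trans (+-congˡ (weight-update horizontal h n x i)) (trans (+-comm z x) x+z≈a))))
    weigh (zx∣a′β i) vertical   = 0+ (trans (+-congˡ (+0 (0+ (weight-update vertical h n x i)))) a+β≈b)

  replicate⁺ : ∀ n {x} → 0# ≤ x → All (0# ≤_) (replicate n x)
  replicate⁺ zero    0≤x = []
  replicate⁺ (suc n) 0≤x = 0≤x ∷ replicate⁺ n 0≤x

  -- `a ≤ b` makes β non-negative. As `a` is positive, `b` can be cut into equal parts of size at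
  -- most `a`, which makes z non-negative. Non-negative weights can serve as squared edge lengths.
  ordered-unavoidableWeights : ∀ {a b} → 0# ≤ a → ¬ (a ≈ 0#) → a ≤ b →
    ∃ λ k → ∃ λ (ws : Vec Carrier k) → All (0# ≤_) ws × Unavoidable (both a b) ws
  ordered-unavoidableWeights {a} {b} 0≤a a≉0 a≤b =
    let β , 0≤β , a+β≈b      = ≤⇒difference a≤b
        n , x , 0≤x , x≤a , nx≈b = equalParts 0≤a a≉0 (≤-trans 0≤a a≤b)
        z , 0≤z , x+z≈a      = ≤⇒difference x≤a
    in 4 ℕ.+ n , a ∷ a ∷ β ∷ z ∷ replicate n x , 0≤a ∷ 0≤a ∷ 0≤β ∷ 0≤z ∷ replicate⁺ n 0≤x ,
       λ I → let L , decomposition , balanced = balancedDecomposition I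
             in L , balanced , decomposition-weight a+β≈b x+z≈a nx≈b decomposition

  unavoidableWeights : ∀ {ℓ} → (∀ s → 0# ≤ ℓ s) → (∀ s → ¬ (ℓ s ≈ 0#)) →
    ∃ λ k → ∃ λ (ws : Vec Carrier k) → All (0# ≤_) ws × Unavoidable ℓ ws
  unavoidableWeights {ℓ} 0≤ℓ ℓ≉0 with total (ℓ horizontal) (ℓ vertical)
  ... | inj₁ ℓh≤ℓv =
    let k , ws , 0≤ws , unavoid = ordered-unavoidableWeights (0≤ℓ horizontal) (ℓ≉0 horizontal) ℓh≤ℓv
    in k , ws , 0≤ws , λ I → let L , balanced , weighs = unavoid I
       in L , balanced , both (weighs horizontal) (weighs vertical)
  ... | inj₂ ℓv≤ℓh =
    let k , ws , 0≤ws , unavoid = ordered-unavoidableWeights (0≤ℓ vertical) (ℓ≉0 vertical) ℓv≤ℓh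
    in k , ws , 0≤ws , λ I → let L , balanced , weighs = unavoid I
       in map (Maybe.map opposite) L , opposite-balanced {I = I} {L} balanced ,
          both (trans (weight-opposite horizontal L ws) (weighs vertical))
               (trans (weight-opposite vertical L ws) (weighs horizontal))

-- Embedding of the grid and its distances.

module Geometry (em : ExcludedMiddle 0ℓ) (ℝ : CompleteOrderedField) where
  open CompleteOrderedField ℝ hiding (zero)
  open OrderedField em ℝ
  open Weights em ℝ
  open Euclidean ℝ
  open Algebra.Properties.CommutativeSemigroup +-commutativeSemigroup using (interchange)
  open Algebra.Properties.Ring ring
  open Algebra.Properties.Semiring.Sum semiring using (sum; sum-cong-≋; ∑-distrib-+)
  open Algebra.Solver.Ring.NaturalCoefficients.Default commutativeSemiring using (solve; _:=_; _:+_; _:*_)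
  open Data.Vec.Functional.Relation.Binary.Equality.Setoid setoid using (_≋_)
  open Relation.Binary.Reasoning.Setoid setoid

  origin : ∀ {n} → Point n
  origin _ = 0#

  sq-cong : ∀ {x y} → x ≈ y → x * x ≈ y * y
  sq-cong x≈y = *-cong x≈y x≈y

  [x-y]²≈[y-x]² : ∀ x y → (x - y) * (x - y) ≈ (y - x) * (y - x)
  [x-y]²≈[y-x]² x y = begin
    (x - y) * (x - y)          ≈⟨ sq-cong (⁻¹-anti-homo‿- y x) ⟨
    - (y - x) * - (y - x)      ≈⟨ -‿distribˡ-* (y - x) (- (y - x)) ⟨
    - ((y - x) * - (y - x))    ≈⟨ -‿cong (-‿distribʳ-* (y - x) (y - x)) ⟨
    - (- ((y - x) * (y - x)))  ≈⟨ -‿involutive _ ⟩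
    (y - x) * (y - x)          ∎

  x-0≈x : ∀ x → x - 0# ≈ x
  x-0≈x x = trans (+-congˡ -0#≈0#) (+-identityʳ x)

  telescope : ∀ x y z → (x - y) + (y - z) ≈ x - z
  telescope x y z = begin
    (x - y) + (y - z)    ≈⟨ +-assoc x (- y) (y - z) ⟩
    x + (- y + (y - z))  ≈⟨ +-congˡ (+-assoc (- y) y (- z)) ⟨
    x + (- y + y - z)    ≈⟨ +-congˡ (+-congʳ (-‿inverseˡ y)) ⟩
    x + (0# - z)         ≈⟨ +-congˡ (+-identityˡ (- z)) ⟩
    x - z                ∎

  dist²-cong : ∀ {n} {x x′ y y′ : Point n} → x ≋ x′ → y ≋ y′ → dist² x y ≈ dist² x′ y′
  dist²-cong x≋x′ y≋y′ = sum-cong-≋ λ i → sq-cong (+-cong (x≋x′ i) (-‿cong (y≋y′ i)))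

  dist²-sym : ∀ {n} (x y : Point n) → dist² x y ≈ dist² y x
  dist²-sym x y = sum-cong-≋ λ i → [x-y]²≈[y-x]² (x i) (y i)

  dist²-refl : ∀ {n} (x : Point n) → dist² x x ≈ 0#
  dist²-refl {zero}  x = refl
  dist²-refl {suc n} x = trans (+-cong (trans (sq-cong (-‿inverseʳ (x zero))) (zeroˡ 0#)) (dist²-refl (x ∘ suc)))
    (+-identityˡ 0#)

  dist²-origin : ∀ {n} (x : Point n) → dist² x origin ≈ x ∙ x
  dist²-origin x = sum-cong-≋ λ i → sq-cong (x-0≈x (x i))

  ++-suc : ∀ {m n} (x : Point (suc m)) (y : Point n) → (x ++ y) ∘ suc ≋ (x ∘ suc) ++ y
  ++-suc {m} x y i with splitAt m i
  ... | inj₁ _ = refl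
  ... | inj₂ _ = refl

  dist²-++ : ∀ {m n} (x x′ : Point m) (y y′ : Point n) → dist² (x ++ y) (x′ ++ y′) ≈ dist² x x′ + dist² y y′
  dist²-++ {zero}  x x′ y y′ = sym (+-identityˡ _)
  dist²-++ {suc m} x x′ y y′ = begin
    _ + dist² ((x ++ y) ∘ suc) ((x′ ++ y′) ∘ suc)         ≈⟨ +-congˡ (dist²-cong (++-suc x y) (++-suc x′ y′)) ⟩
    _ + dist² ((x ∘ suc) ++ y) ((x′ ∘ suc) ++ y′)         ≈⟨ +-congˡ (dist²-++ (x ∘ suc) (x′ ∘ suc) y y′) ⟩
    _ + (dist² (x ∘ suc) (x′ ∘ suc) + dist² y y′)         ≈⟨ +-assoc _ _ _ ⟨
    dist² x x′ + dist² y y′                               ∎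

  -- The multiples by `c` of the standard unit vectors; they are the vertices of a regular simplex.
  spike : ∀ {N} → Carrier → Fin N → Point N
  spike c zero    zero    = c
  spike c zero    (suc j) = 0#
  spike c (suc i) zero    = 0#
  spike c (suc i) (suc j) = spike c i j

  origin∙origin : ∀ n → origin {n} ∙ origin ≈ 0#
  origin∙origin n = trans (sym (dist²-origin {n} origin)) (dist²-refl {n} origin)

  spike∙spike : ∀ {N} c (i : Fin N) → spike c i ∙ spike c i ≈ c * c
  spike∙spike {suc N} c zero    = trans (+-congˡ (origin∙origin N)) (+-identityʳ (c * c))
  spike∙spike c (suc i) = trans (+-cong (zeroˡ 0#) (spike∙spike c i)) (+-identityˡ (c * c))

  dist²-spike : ∀ {N} c {i j : Fin N} → i ≢ j → dist² (spike c i) (spike c j) ≈ c * c + c * c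
  dist²-spike c {zero}  {zero}  i≢j = contradiction ≡.refl i≢j
  dist²-spike c {suc i} {zero}  i≢j = +-cong
    (trans ([x-y]²≈[y-x]² 0# c) (sq-cong (x-0≈x c)))
    (trans (dist²-origin (spike c i)) (spike∙spike c i))
  dist²-spike c {zero}  {suc j} i≢j = trans (dist²-sym (spike c zero) (spike c (suc j))) (dist²-spike c (i≢j ∘ ≡.sym))
  dist²-spike c {suc i} {suc j} i≢j = trans
    (+-cong (trans (sq-cong (-‿inverseʳ 0#)) (zeroˡ 0#)) (dist²-spike c (i≢j ∘ ≡.cong suc)))
    (+-identityˡ _)

  -- The product of k regular simplices with N vertices each; the squared edge
  -- length of the i-th one is the i-th weight.
  embed : ∀ {k N} {ws : Vec Carrier k} → All (0# ≤_) ws → Vec (Fin N) k → Point (k ℕ.* N)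
  embed []           []       = origin
  embed (0≤w ∷ 0≤ws) (i ∷ is) = spike (proj₁ (halfSqrt 0≤w)) i ++ embed 0≤ws is

  dist²-block : ∀ {N w} (0≤w : 0# ≤ w) (g : Bool → Fin N) → g false ≢ g true → ∀ b b′ →
    let c = proj₁ (halfSqrt 0≤w) in dist² (spike c (g b)) (spike c (g b′)) ≈ gate (b xor b′) w
  dist²-block 0≤w g g≢ true  true  = dist²-refl (spike _ (g true))
  dist²-block 0≤w g g≢ true  false = trans (dist²-spike _ (g≢ ∘ ≡.sym)) (proj₂ (halfSqrt 0≤w))
  dist²-block 0≤w g g≢ false true  = trans (dist²-spike _ g≢) (proj₂ (halfSqrt 0≤w))
  dist²-block 0≤w g g≢ false false = dist²-refl (spike _ (g false))

  -- Pythagoras: the squared distance between the corners `κ` and `κ′` of a rectangle with squared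
  -- sides `ℓ`.
  separation : (Side → Bool) → (Side → Bool) → (Side → Carrier) → Carrier
  separation κ κ′ ℓ =
    gate (κ horizontal xor κ′ horizontal) (ℓ horizontal) + gate (κ vertical xor κ′ vertical) (ℓ vertical)

  separation-cong : ∀ κ κ′ {ℓ ℓ′} → (∀ s → ℓ s ≈ ℓ′ s) → separation κ κ′ ℓ ≈ separation κ κ′ ℓ′
  separation-cong κ κ′ ℓ≈ℓ′ = +-cong
    (gate-cong (κ horizontal xor κ′ horizontal) (ℓ≈ℓ′ horizontal))
    (gate-cong (κ vertical xor κ′ vertical) (ℓ≈ℓ′ vertical))

  separation-+ : ∀ κ κ′ ℓ ℓ′ → separation κ κ′ ℓ + separation κ κ′ ℓ′ ≈ separation κ κ′ (λ s → ℓ s + ℓ′ s)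
  separation-+ κ κ′ ℓ ℓ′ = trans (interchange _ _ _ _) (sym (+-cong
    (gate-+ (κ horizontal xor κ′ horizontal) (ℓ horizontal) (ℓ′ horizontal))
    (gate-+ (κ vertical xor κ′ vertical) (ℓ vertical) (ℓ′ vertical))))

  separation-zero : ∀ κ κ′ → separation κ κ′ (λ _ → 0#) ≈ 0#
  separation-zero κ κ′ = trans
    (+-cong (gate-0# (κ horizontal xor κ′ horizontal)) (gate-0# (κ vertical xor κ′ vertical)))
    (+-identityˡ 0#)

  -- A coordinate lies on at most one side, so at most one of the two terms receives `w`, and the
  -- other vanishes.
  separation-label : ∀ κ κ′ l w →
    gate (maybe κ false l xor maybe κ′ false l) w ≈ separation κ κ′ (λ s → gate (l isOn s) w)
  separation-label κ κ′ nothing           w = sym (separation-zero κ κ′)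
  separation-label κ κ′ (just horizontal) w =
    sym (trans (+-congˡ (gate-0# (κ vertical xor κ′ vertical))) (+-identityʳ _))
  separation-label κ κ′ (just vertical)   w =
    sym (trans (+-congʳ (gate-0# (κ horizontal xor κ′ horizontal))) (+-identityˡ _))

  -- Squared distances add up over the blocks, `separation` is additive in the squared sides, and a
  -- block contributes its weight exactly if the two corners differ there.
  dist²-embed : ∀ {k N} {ws : Vec Carrier k} (0≤ws : All (0# ≤_) ws) {f : Vec (Bool → Fin N) k} →
    All (λ g → g false ≢ g true) f → ∀ L κ κ′ →
    dist² (embed 0≤ws (f ⊛ vertexOf L κ)) (embed 0≤ws (f ⊛ vertexOf L κ′)) ≈
    separation κ κ′ (λ s → weight s L ws)
  dist²-embed [] [] [] κ κ′ = sym (separation-zero κ κ′)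
  dist²-embed {ws = w ∷ ws} (0≤w ∷ 0≤ws) {g ∷ f} (g≢ ∷ f≢) (l ∷ L) κ κ′ = begin
    dist² (spike c (g b) ++ p) (spike c (g b′) ++ p′)
      ≈⟨ dist²-++ (spike c (g b)) (spike c (g b′)) p p′ ⟩
    dist² (spike c (g b)) (spike c (g b′)) + dist² p p′
      ≈⟨ +-cong (trans (dist²-block 0≤w g g≢ b b′) (separation-label κ κ′ l w)) (dist²-embed 0≤ws f≢ L κ κ′) ⟩
    separation κ κ′ (λ s → gate (l isOn s) w) + separation κ κ′ (λ s → weight s L ws)
      ≈⟨ separation-+ κ κ′ (λ s → gate (l isOn s) w) (λ s → weight s L ws) ⟩
    separation κ κ′ (λ s → weight s (l ∷ L) (w ∷ ws)) ∎
    where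
    c  = proj₁ (halfSqrt 0≤w)
    b  = maybe κ false l
    b′ = maybe κ′ false l
    p  = embed 0≤ws (f ⊛ vertexOf L κ)
    p′ = embed 0≤ws (f ⊛ vertexOf L κ′)

  sum-squares-nonNeg : ∀ {n} (x : Point n) → 0# ≤ x ∙ x
  sum-squares-nonNeg {zero}  x = ≤-refl
  sum-squares-nonNeg {suc n} x = +-nonNeg (square-nonNeg (x zero)) (sum-squares-nonNeg (x ∘ suc))

  ∙-definite : ∀ {n} (x : Point n) → x ∙ x ≈ 0# → ∀ i → x i ≈ 0#
  ∙-definite x x∙x≈0 zero    = square≈0 (sum≈0⇒≈0 (square-nonNeg (x zero)) (sum-squares-nonNeg (x ∘ suc)) x∙x≈0)
  ∙-definite x x∙x≈0 (suc i) = ∙-definite (x ∘ suc)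
    (sum≈0⇒≈0 (sum-squares-nonNeg (x ∘ suc)) (square-nonNeg (x zero)) (trans (+-comm _ _) x∙x≈0)) i

  dist²-definite : ∀ {n} (x y : Point n) → dist² x y ≈ 0# → x ≋ y
  dist²-definite x y eq i = x∙y⁻¹≈ε⇒x≈y (x i) (y i) (∙-definite (x ⊖ y) eq i)

  -- Distances in the given rectangle, and its copies in the grid.

  module _ {d} (T : Rectangle d) where
    open Rectangle T

    width height : Point d
    width  = points 1F ⊖ points 0F
    height = points 3F ⊖ points 0F

    sideLength² : Side → Carrier
    sideLength² = both (width ∙ width) (height ∙ height)

    sideLength²-nonNeg : ∀ s → 0# ≤ sideLength² s
    sideLength²-nonNeg = both (sum-squares-nonNeg width) (sum-squares-nonNeg height)

    sideLength²≉0 : ∀ s → ¬ (sideLength² s ≈ 0#)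
    sideLength²≉0 horizontal eq = contradiction (distinct (dist²-definite (points 1F) (points 0F) eq)) λ ()
    sideLength²≉0 vertical   eq = contradiction (distinct (dist²-definite (points 3F) (points 0F) eq)) λ ()

    -- Twice the inner product of the sides, in the shape of the cross term of a squared sum.
    ∑-orthogonal : sum (λ i → width i * height i + width i * height i) ≈ 0#
    ∑-orthogonal = begin
      sum (λ i → width i * height i + width i * height i)  ≈⟨ ∑-distrib-+ (λ i → width i * height i) _ ⟩
      width ∙ height + width ∙ height                      ≈⟨ +-cong rightAngle rightAngle ⟩
      0# + 0#                                              ≈⟨ +-identityˡ 0# ⟩
      0#                                                   ∎

    diagonal : ∀ (x : Point d) → (∀ i → width i + height i ≈ x i) → x ∙ x ≈ width ∙ width + height ∙ height
    diagonal x w+h≈x = begin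
      x ∙ x
        ≈⟨ sum-cong-≋ (λ i → trans (sq-cong (sym (w+h≈x i)))
             (solve 2 (λ a b → (a :+ b) :* (a :+ b) := (a :* a :+ b :* b) :+ (a :* b :+ a :* b))
               refl (width i) (height i))) ⟩
      sum (λ i → (width i * width i + height i * height i) + (width i * height i + width i * height i))
        ≈⟨ ∑-distrib-+ (λ i → width i * width i + height i * height i) _ ⟩
      sum (λ i → width i * width i + height i * height i) + sum (λ i → width i * height i + width i * height i)
        ≈⟨ +-cong (∑-distrib-+ (λ i → width i * width i) _) ∑-orthogonal ⟩
      (width ∙ width + height ∙ height) + 0#
        ≈⟨ +-identityʳ _ ⟩
      width ∙ width + height ∙ height ∎

    -- To avoid subtraction, twice the inner product of the sides, which vanishes, is added to
    -- `x ∙ x`, and `height` is replaced by `x` plus `width`.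
    antidiagonal : ∀ (x : Point d) → (∀ i → x i + width i ≈ height i) → x ∙ x ≈ width ∙ width + height ∙ height
    antidiagonal x x+w≈h = begin
      x ∙ x
        ≈⟨ +-identityʳ (x ∙ x) ⟨
      x ∙ x + 0#
        ≈⟨ +-congˡ ∑-orthogonal ⟨
      x ∙ x + sum (λ i → width i * height i + width i * height i)
        ≈⟨ ∑-distrib-+ (λ i → x i * x i) _ ⟨
      sum (λ i → x i * x i + (width i * height i + width i * height i))
        ≈⟨ sum-cong-≋ pointwise ⟩
      sum (λ i → width i * width i + height i * height i)
        ≈⟨ ∑-distrib-+ (λ i → width i * width i) _ ⟩
      width ∙ width + height ∙ height ∎
      where
      pointwise : ∀ i → x i * x i + (width i * height i + width i * height i) ≈
                        width i * width i + height i * height i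
      pointwise i = begin
        x i * x i + (width i * height i + width i * height i)
          ≈⟨ +-congˡ (+-cong (*-congˡ (x+w≈h i)) (*-congˡ (x+w≈h i))) ⟨
        x i * x i + (width i * (x i + width i) + width i * (x i + width i))
          ≈⟨ solve 2 (λ x w → x :* x :+ (w :* (x :+ w) :+ w :* (x :+ w)) := w :* w :+ (x :+ w) :* (x :+ w))
               refl (x i) (width i) ⟩
        width i * width i + (x i + width i) * (x i + width i)
          ≈⟨ +-congˡ (sq-cong (x+w≈h i)) ⟩
        width i * width i + height i * height i ∎

    -- Puts the distances in `T` into the form that `dist²-embed` yields for the grid, so that only
    -- the side lengths remain to be compared.
    dist²-vertices : ∀ i j → dist² (points i) (points j) ≈ separation (corner i) (corner j) sideLength²
    dist²-vertices 0F 0F = trans (dist²-refl (points 0F)) (sym (+-identityˡ 0#))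
    dist²-vertices 1F 1F = trans (dist²-refl (points 1F)) (sym (+-identityˡ 0#))
    dist²-vertices 2F 2F = trans (dist²-refl (points 2F)) (sym (+-identityˡ 0#))
    dist²-vertices 3F 3F = trans (dist²-refl (points 3F)) (sym (+-identityˡ 0#))
    dist²-vertices 1F 0F = sym (+-identityʳ _)
    dist²-vertices 3F 0F = sym (+-identityˡ _)
    dist²-vertices 2F 3F = trans (sum-cong-≋ λ i → sq-cong (sym (parallelogram i))) (sym (+-identityʳ _))
    -- `parallelogram` moves `width` to the side from 3F to 2F, where `height` continues it to the
    -- diagonal.
    dist²-vertices 2F 0F = diagonal (points 2F ⊖ points 0F) λ i →
      trans (+-congʳ (parallelogram i)) (telescope (points 2F i) (points 3F i) (points 0F i))
    dist²-vertices 2F 1F = trans (sum-cong-≋ λ i → sq-cong (begin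
      points 2F i - points 1F i                                    ≈⟨ telescope _ (points 3F i) _ ⟨
      (points 2F i - points 3F i) + (points 3F i - points 1F i)    ≈⟨ +-congʳ (parallelogram i) ⟨
      (points 1F i - points 0F i) + (points 3F i - points 1F i)    ≈⟨ +-comm _ _ ⟩
      (points 3F i - points 1F i) + (points 1F i - points 0F i)    ≈⟨ telescope _ (points 1F i) _ ⟩
      points 3F i - points 0F i                                    ∎)) (sym (+-identityˡ _))
    dist²-vertices 3F 1F = antidiagonal (points 3F ⊖ points 1F) λ i → telescope _ (points 1F i) _
    dist²-vertices 0F 1F = trans (dist²-sym (points 0F) (points 1F)) (dist²-vertices 1F 0F)
    dist²-vertices 0F 2F = trans (dist²-sym (points 0F) (points 2F)) (dist²-vertices 2F 0F)
    dist²-vertices 0F 3F = trans (dist²-sym (points 0F) (points 3F)) (dist²-vertices 3F 0F)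
    dist²-vertices 1F 2F = trans (dist²-sym (points 1F) (points 2F)) (dist²-vertices 2F 1F)
    dist²-vertices 1F 3F = trans (dist²-sym (points 1F) (points 3F)) (dist²-vertices 3F 1F)
    dist²-vertices 3F 2F = trans (dist²-sym (points 3F) (points 2F)) (dist²-vertices 2F 3F)

    gallaiRamsey : ∃ λ n₀ → ∀ r n → n₀ ℕ.≤ n → 𝔼^ n ⟶[ r ]⟨ vertices ⨾ vertices ⟩GR
    gallaiRamsey =
      let k , ws , 0≤ws , unavoid = unavoidableWeights sideLength²-nonNeg sideLength²≉0
          N , canonical           = canonicalRamsey k
      -- `k` and the weights come from `T`, and `N` from `k` alone, so this dimension does not
      -- depend on `r`. The `m` surplus dimensions are filled with zeros.
      in k ℕ.* N , λ r n n₀≤n → let m , n₀+m≡n = ℕ.m≤n⇒∃[o]m+o≡n n₀≤n in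
         ≡.subst (λ n → 𝔼^ n ⟶[ r ]⟨ vertices ⨾ vertices ⟩GR) n₀+m≡n (arrow k ws 0≤ws unavoid N canonical r m)
      where
      arrow : ∀ k (ws : Vec Carrier k) (0≤ws : All (0# ≤_) ws) → Unavoidable sideLength² ws →
              ∀ N → HasCanonicalCubes k N →
              ∀ r m → 𝔼^ (k ℕ.* N ℕ.+ m) ⟶[ r ]⟨ vertices ⨾ vertices ⟩GR
      arrow k ws 0≤ws unavoid N canonical r m χ
        with canonical (λ is → Func.to χ (embed 0≤ws is ++ origin {m}))
      ... | f , f≢ , I , can with unavoid I
      ...   | L , balanced , weighs = conclude balanced
        where
        copy : CongruentCopy vertices (k ℕ.* N ℕ.+ m)
        copy = record
          { copy      = λ i → embed 0≤ws (f ⊛ vertexOf L (corner i)) ++ origin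
          ; isometric = λ i j → begin
              dist² (embed 0≤ws (f ⊛ vertexOf L (corner i)) ++ origin {m})
                    (embed 0≤ws (f ⊛ vertexOf L (corner j)) ++ origin)
                ≈⟨ dist²-++ (embed 0≤ws (f ⊛ vertexOf L (corner i))) _ (origin {m}) origin ⟩
              dist² (embed 0≤ws (f ⊛ vertexOf L (corner i))) (embed 0≤ws (f ⊛ vertexOf L (corner j)))
                + dist² (origin {m}) origin
                ≈⟨ trans (+-congˡ (dist²-refl (origin {m}))) (+-identityʳ _) ⟩
              dist² (embed 0≤ws (f ⊛ vertexOf L (corner i))) (embed 0≤ws (f ⊛ vertexOf L (corner j)))
                ≈⟨ dist²-embed 0≤ws f≢ L (corner i) (corner j) ⟩
              separation (corner i) (corner j) (λ s → weight s L ws)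
                ≈⟨ separation-cong (corner i) (corner j) weighs ⟩
              separation (corner i) (corner j) sideLength²
                ≈⟨ dist²-vertices i j ⟨
              dist² (points i) (points j) ∎
          }

        conclude : Balanced I L → Σ (CongruentCopy vertices _) (Monochromatic χ) ⊎
                                  Σ (CongruentCopy vertices _) (Rainbow χ)
        conclude (inj₂ unseen) = inj₁ (copy , λ i j →
          proj₁ (can (vertexOf L (corner i)) (vertexOf L (corner j)))
            (vertexOf-agree {I = I} {L} unseen (corner i) (corner j)))
        -- Equal colours force agreement on `I`, where both sides are seen, hence equal corners.
        conclude (inj₁ seen) = inj₂ (copy , λ {i} {j} eq → corner-injective λ s →
          agree⇒≡ {I = I} {L} (seen s) (corner i) (corner j)
            (proj₂ (can (vertexOf L (corner i)) (vertexOf L (corner j))) eq))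

open import Data.Nat.Base using (_≤_)

theorem1p1 : ExcludedMiddle 0ℓ → (ℝ : CompleteOrderedField) →
    let open Euclidean ℝ in
    ∀ {d : ℕ} (T : Rectangle d) →
    ∃ λ (n₀ : ℕ) → ∀ (r n : ℕ) → 1 ≤ r → n₀ ≤ n →
    𝔼^ n ⟶[ r ]⟨ Rectangle.vertices T ⨾ Rectangle.vertices T ⟩GR
theorem1p1 em ℝ T =
  let n₀ , arrow = Geometry.gallaiRamsey em ℝ T in n₀ , λ r n _ → arrow r n
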